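{- Let $m \geq 3$ be an integer. Then \[ \alpha(C(C_{m}))=\begin{cases} k(k+1)+\left\lfloor (k+1)/2\right\rfloor & \text{if } m=2k+1,\\ k(k+1) & \text{if } m=2k,\end{cases} \] where $k$ is an integer.
   Context: Graphs are finite and simple. For a graph $G$, the pair graph $C(G)$ (also called complete double vertex graph) is the graph whose vertices are all $2$-multisets of $V(G)$ (so $\{x,x\}$ is allowed), where two vertices $\{x,y\}$ and $\{u,v\}$ are adjacent if and only if $\{x,y\}\cap\{u,v\}=\{a\}$ (multiset intersection) for some $a$ and, writing $x=u=a$, the vertices $y$ and $v$ are adjacent in $G$; that is, the two multisets can be written as $\{a,y\}$ and $\{a,v\}$ with $yv$ an edge of $G$. $C_m$ is the cycle with $m$ vertices, and $C(C_m)$ is its pair graph. $\alpha(G)$ denotes the independence number of $G$. -}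

module Defs where

open import Data.Fin using (Fin; toℕ)
open import Data.List using (List; length; allFin; cartesianProduct)
open import Data.List.Membership.Propositional.Properties using (∈-allFin)
open import Data.List.Relation.Unary.Any as Any using ()
open import Data.List.Relation.Unary.Enumerates.Setoid using (IsEnumeration)
open import Data.List.Relation.Unary.Enumerates.Setoid.Properties
  using (cartesianProduct⁺)
import Data.List.Membership.Setoid as Membership
import Data.List.Relation.Unary.Unique.Setoid as UniqueSetoid
open import Data.Nat using (ℕ; zero; suc; _≤_; s≤s)
open import Data.Nat.Properties using (1+n≢n)
open import Data.Product using (_×_; _,_; ∃-syntax)
open import Data.Sum using (_⊎_; inj₁; inj₂; swap)
open import Level using (0ℓ)
open import Relation.Binary using (Setoid; Rel; Symmetric)
open import Relation.Binary.PropositionalEquality as ≡ using (_≡_; refl)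
open import Relation.Nullary using (¬_)

-- Vertices form a setoid, so that unordered pairs can serve as vertices.
record Graph : Set₁ where
  infix 4 _~_
  field
    vertexSetoid : Setoid 0ℓ 0ℓ
  open Setoid vertexSetoid public renaming (Carrier to Vertex)
  field
    _~_      : Rel Vertex 0ℓ
    ~-resp-≈ : ∀ {x x′ y y′} → x ≈ x′ → y ≈ y′ → x ~ y → x′ ~ y′
    ~-sym    : Symmetric _~_
    ~-irrefl : ∀ {x} → ¬ (x ~ x)
    vertices : List Vertex
    finite   : IsEnumeration vertexSetoid vertices

module _ (G : Graph) where
  open Graph G
  open Membership vertexSetoid using (_∈_)
  open UniqueSetoid vertexSetoid using (Unique)

  -- Finite sets of vertices are repetition-free lists (up to _≈_), so that
  -- the cardinality is the length.
  record IsIndependentSet (S : List Vertex) : Set where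
    field
      unique      : Unique S
      nonadjacent : ∀ {x y} → x ∈ S → y ∈ S → ¬ (x ~ y)

  -- α(G) = n
  record IsIndependenceNumber (n : ℕ) : Set where
    field
      attained : ∃[ S ] (IsIndependentSet S × length S ≡ n)
      maximal  : ∀ S → IsIndependentSet S → length S ≤ n

-- 2-multisets {x , y}, with x and y possibly equal: ordered pairs up to swapping.
multiset₂ : Setoid 0ℓ 0ℓ → Setoid 0ℓ 0ℓ
multiset₂ V = record
  { Carrier       = Carrier × Carrier
  ; _≈_           = λ (x , y) (u , v) → (x ≈ u × y ≈ v) ⊎ (x ≈ v × y ≈ u)
  ; isEquivalence = record
    { refl  = inj₁ (≈-refl , ≈-refl)
    ; sym   = λ { (inj₁ (p , q)) → inj₁ (sym p , sym q)
                ; (inj₂ (p , q)) → inj₂ (sym q , sym p) }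
    ; trans = λ { (inj₁ (p , q)) (inj₁ (r , s)) → inj₁ (trans p r , trans q s)
                ; (inj₁ (p , q)) (inj₂ (r , s)) → inj₂ (trans p r , trans q s)
                ; (inj₂ (p , q)) (inj₁ (r , s)) → inj₂ (trans p s , trans q r)
                ; (inj₂ (p , q)) (inj₂ (r , s)) → inj₁ (trans p s , trans q r) }
    }
  }
  where open Setoid V renaming (refl to ≈-refl)

module _ (G : Graph) where
  open Graph G
  private
    module M = Setoid (multiset₂ vertexSetoid)

  -- The multiset intersection of {a , y} and {a , v} is exactly {a} here,
  -- because y ~ v forces y and v to be distinct.
  PairAdjacent : Rel (Vertex × Vertex) 0ℓ
  PairAdjacent p q =
    ∃[ a ] ∃[ y ] ∃[ v ] (p M.≈ (a , y) × q M.≈ (a , v) × y ~ v)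

  pairGraph : Graph
  pairGraph = record
    { vertexSetoid = multiset₂ vertexSetoid
    ; _~_          = PairAdjacent
    ; ~-resp-≈     = λ p≈ q≈ (a , y , v , p , q , y~v) →
        a , y , v , M.trans (M.sym p≈) p , M.trans (M.sym q≈) q , y~v
    ; ~-sym        = λ (a , y , v , p , q , y~v) → a , v , y , q , p , ~-sym y~v
    ; ~-irrefl     = λ (a , y , v , p , q , y~v) →
        ~-irrefl (~-resp-≈ (cancel (M.trans (M.sym p) q)) (Graph.refl G) y~v)
    ; vertices     = cartesianProduct vertices vertices
    ; finite       = λ p → Any.map inj₁
        (cartesianProduct⁺ vertexSetoid vertexSetoid finite finite p)
    }
    where
    cancel : ∀ {a y v} → (a , y) M.≈ (a , v) → y ≈ v
    cancel (inj₁ (_ , y≈v))   = y≈v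
    cancel (inj₂ (a≈v , y≈a)) = Graph.trans G y≈a a≈v

-- j = i + 1 (mod m)
CyclicSuc : ∀ {m} → Rel (Fin m) 0ℓ
CyclicSuc {m} i j =
  (toℕ j ≡ suc (toℕ i)) ⊎ (suc (toℕ i) ≡ m × toℕ j ≡ 0)

cycle : (m : ℕ) → 3 ≤ m → Graph
cycle m 3≤m = record
  { vertexSetoid = ≡.setoid (Fin m)
  ; _~_          = λ i j → CyclicSuc i j ⊎ CyclicSuc j i
  ; ~-resp-≈     = λ { refl refl i~j → i~j }
  ; ~-sym        = swap
  ; ~-irrefl     = λ { (inj₁ s) → irrefl 3≤m s ; (inj₂ s) → irrefl 3≤m s }
  ; vertices     = allFin m
  ; finite       = ∈-allFin
  }
  where
  1≱3 : ¬ (3 ≤ 1)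
  1≱3 (s≤s ())

  irrefl : ∀ {m} {i : Fin m} → 3 ≤ m → ¬ CyclicSuc i i
  irrefl         _   (inj₁ i≡1+i)        = 1+n≢n (≡.sym i≡1+i)
  irrefl {i = i} 3≤m (inj₂ (1+i≡m , i≡0)) with toℕ i
  irrefl 3≤m (inj₂ (refl , refl)) | zero = 1≱3 3≤m

{-# OPTIONS --safe #-}
-- Upper bound: count every member {x , y} of an independent set S once at each
-- of its two ends.  The count at x distributes the other ends over the closed
-- walk x , x + 1 , … , x + m, whose endpoints both stand for {x , x}, so that
-- the two ends of {x , x} occupy different positions.  Cut the walk into
-- ⌊m/2⌋ + 1 blocks of at most two consecutive positions: each block is used at
-- most once, since the pairs at consecutive positions are adjacent.  Hence
-- 2|S| ≤ m(⌊m/2⌋ + 1).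
--
-- Lower bound: for x ≤ y call e = m − (y − x) the gap of {x , y}; exactly e pairs
-- have gap e.  Adjacent pairs have gaps that differ by 1 or add up to m + 1, so
-- any set of gaps free of such coincidences gives an independent set.  For
-- m = 2k take all even gaps; for m = 2k + 1 the even gaps ≤ k and the odd
-- gaps > k + 1.
module Submission where

open import Defs
open import Data.Fin using (Fin; zero; suc; toℕ; fromℕ<; inject≤; cast; _↑ʳ_; combine; remQuot)
open import Data.Fin.Properties
  using (toℕ<n; toℕ-injective; fromℕ<-injective; toℕ-cast; toℕ-↑ʳ; toℕ-inject≤;
         inject≤-injective; injective⇒≤; combine-injective; combine-remQuot)
open import Data.List using (List; []; _∷_; _++_; length; lookup; tabulate; applyDownFrom)
open import Data.List.Properties using (length-++; length-tabulate)
open import Data.List.Membership.Propositional using (_∈_)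
open import Data.List.Membership.Propositional.Properties
  using (∈-applyDownFrom⁻; ∈-++⁻; ∈-lookup)
open import Data.List.Relation.Unary.All as All using (All; []; _∷_)
import Data.List.Relation.Unary.All.Properties as All
open import Data.List.Relation.Unary.AllPairs using ([]; _∷_)
import Data.List.Relation.Unary.AllPairs.Properties as AllPairs
open import Data.List.Relation.Unary.Any as Any using (here; there)
import Data.List.Relation.Unary.Unique.Setoid as UniqueSetoid
open import Data.List.Relation.Unary.Unique.Propositional using (Unique)
import Data.List.Membership.Setoid as Membership
open import Data.Nat
  using (ℕ; zero; suc; _+_; _*_; _∸_; _/_; _%_; _≤_; _<_; z≤n; s≤s; s≤s⁻¹; ⌊_/2⌋; ⌈_/2⌉; NonZero)
open import Data.Nat.Divisibility using (∣-refl; n∣m*n)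
open import Data.Nat.DivMod
  using (%-distribˡ-+; m%n%n≡m%n; m<n⇒m%n≡m; n%n≡0; [m+n]%n≡m%n; m%n<n; m*n/n≡m; +-distrib-/-∣ˡ; /-monoˡ-≤)
open import Data.Nat.ListAction using (sum)
open import Data.Nat.ListAction.Properties using (sum-++)
open import Data.Nat.Properties
open import Data.Nat.Tactic.RingSolver using (solve-∀)
open import Data.Product using (_×_; _,_; proj₁; proj₂; ∃-syntax; swap)
open import Data.Sum using (_⊎_; inj₁; inj₂)
open import Function using (_∘_)
open import Function.Definitions using (Injective)
open import Level using (0ℓ)
open import Relation.Binary using (Setoid)
open import Relation.Binary.PropositionalEquality
  using (_≡_; refl; sym; trans; cong; cong₂; subst; module ≡-Reasoning)
open import Relation.Nullary using (¬_; contradiction)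

-- Remainders, halving and positions in repetition-free lists.

%-+ʳ : ∀ x y m .{{_ : NonZero m}} → (x + y % m) % m ≡ (x + y) % m
%-+ʳ x y m = begin
  (x + y % m) % m           ≡⟨ %-distribˡ-+ x (y % m) m ⟩
  (x % m + y % m % m) % m   ≡⟨ cong (λ z → (x % m + z) % m) (m%n%n≡m%n y m) ⟩
  (x % m + y % m) % m       ≡⟨ %-distribˡ-+ x y m ⟨
  (x + y) % m               ∎
  where open ≡-Reasoning

⌊n/2⌋≡n/2 : ∀ n → ⌊ n /2⌋ ≡ n / 2
⌊n/2⌋≡n/2 0             = refl
⌊n/2⌋≡n/2 1             = refl
⌊n/2⌋≡n/2 (suc (suc n)) = trans (cong suc (⌊n/2⌋≡n/2 n)) (sym (+-distrib-/-∣ˡ n (∣-refl {2})))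

⌊2n/2⌋≡n : ∀ n → ⌊ 2 * n /2⌋ ≡ n
⌊2n/2⌋≡n n = trans (cong (λ x → ⌊ n + x /2⌋) (+-identityʳ n)) (sym (n≡⌊n+n/2⌋ n))

⌊1+2n/2⌋≡n : ∀ n → ⌊ suc (2 * n) /2⌋ ≡ n
⌊1+2n/2⌋≡n zero    = refl
⌊1+2n/2⌋≡n (suc n) = trans (cong (⌊_/2⌋ ∘ suc) (*-suc 2 n)) (cong suc (⌊1+2n/2⌋≡n n))

-- Halving groups the positions as {2i , 2i + 1}; these fibres are the blocks of the walk.
⌊/2⌋-fibre : ∀ p q → ⌊ p /2⌋ ≡ ⌊ q /2⌋ → p ≡ q ⊎ suc p ≡ q ⊎ suc q ≡ p
⌊/2⌋-fibre 0             0             _  = inj₁ refl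
⌊/2⌋-fibre 0             1             _  = inj₂ (inj₁ refl)
⌊/2⌋-fibre 1             0             _  = inj₂ (inj₂ refl)
⌊/2⌋-fibre 1             1             _  = inj₁ refl
⌊/2⌋-fibre (suc (suc p)) (suc (suc q)) eq with ⌊/2⌋-fibre p q (suc-injective eq)
... | inj₁ refl        = inj₁ refl
... | inj₂ (inj₁ refl) = inj₂ (inj₁ refl)
... | inj₂ (inj₂ refl) = inj₂ (inj₂ refl)

module _ (V : Setoid 0ℓ 0ℓ) where
  open Setoid V using (Carrier; _≈_) renaming (sym to ≈-sym)

  Unique⇒lookup-injective : ∀ {xs : List Carrier} → UniqueSetoid.Unique V xs →
    ∀ i j → lookup xs i ≈ lookup xs j → i ≡ j
  Unique⇒lookup-injective (x∉ ∷ u) zero    zero    _  = refl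
  Unique⇒lookup-injective (x∉ ∷ u) zero    (suc j) eq =
    contradiction eq (All.lookup x∉ (∈-lookup j))
  Unique⇒lookup-injective (x∉ ∷ u) (suc i) zero    eq =
    contradiction (≈-sym eq) (All.lookup x∉ (∈-lookup i))
  Unique⇒lookup-injective (x∉ ∷ u) (suc i) (suc j) eq =
    cong suc (Unique⇒lookup-injective u i j eq)

  lookup∈ : ∀ (xs : List Carrier) i → Membership._∈_ V (lookup xs i) xs
  lookup∈ xs i = Any.map (λ { refl → Setoid.refl V }) (∈-lookup {xs = xs} i)

-- Upper bound

module _ {m : ℕ} .{{_ : NonZero m}} where

  CyclicSuc-% : ∀ {i j : Fin m} x → x % m ≡ toℕ i → suc x % m ≡ toℕ j → CyclicSuc i j
  CyclicSuc-% {i} {j} x x≡i 1+x≡j = cases (m≤n⇒m<n∨m≡n (toℕ<n i))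
    where
    j≡1+i : toℕ j ≡ suc (toℕ i) % m
    j≡1+i = trans (sym 1+x≡j) (trans (sym (%-+ʳ 1 x m)) (cong (λ y → suc y % m) x≡i))

    cases : suc (toℕ i) < m ⊎ suc (toℕ i) ≡ m → CyclicSuc i j
    cases (inj₁ 1+i<m) = inj₁ (trans j≡1+i (m<n⇒m%n≡m 1+i<m))
    cases (inj₂ 1+i≡m) = inj₂ (1+i≡m , trans j≡1+i (trans (cong (_% m) 1+i≡m) (n%n≡0 m)))

  -- Counts the steps forward from `c` to `b`, with `m ∸ c` standing for -c modulo `m`. The start is
  -- a number rather than a vertex, since the second end of a pair at the last vertex starts from c
  -- = m.
  offset : ℕ → Fin m → ℕ
  offset c b = (toℕ b + (m ∸ c)) % m

  offset-spec : ∀ {c} → c ≤ m → ∀ b → (c + offset c b) % m ≡ toℕ b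
  offset-spec {c} c≤m b = begin
    (c + offset c b) % m          ≡⟨ %-+ʳ c _ m ⟩
    (c + (toℕ b + (m ∸ c))) % m   ≡⟨ cong (_% m) (rearrange c (toℕ b) (m ∸ c)) ⟩
    (toℕ b + ((m ∸ c) + c)) % m   ≡⟨ cong (λ x → (toℕ b + x) % m) (m∸n+n≡m c≤m) ⟩
    (toℕ b + m) % m               ≡⟨ [m+n]%n≡m%n (toℕ b) m ⟩
    toℕ b % m                     ≡⟨ m<n⇒m%n≡m (toℕ<n b) ⟩
    toℕ b                         ∎
    where
    open ≡-Reasoning
    rearrange : ∀ x y z → x + (y + z) ≡ y + (z + x)
    rearrange = solve-∀

  -- Seen from its first end (s = 0), the position of b on the walk from a ranges
  -- over 0 … m − 1; seen from its second end (s = 1), over 1 … m.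
  position : Fin 2 → Fin m → Fin m → ℕ
  position s a b = toℕ s + offset (toℕ a + toℕ s) b

  position-spec : ∀ s a b → (toℕ a + position s a b) % m ≡ toℕ b
  position-spec s a b = trans
    (cong (_% m) (sym (+-assoc (toℕ a) (toℕ s) _)))
    (offset-spec a+s≤m b)
    where
    a+s≤m : toℕ a + toℕ s ≤ m
    a+s≤m = ≤-trans (+-monoʳ-≤ (toℕ a) (s≤s⁻¹ (toℕ<n s)))
                    (≤-trans (≤-reflexive (+-comm (toℕ a) 1)) (toℕ<n a))

  position≤m : ∀ s a b → position s a b ≤ m
  position≤m s a b = ≤-trans (+-monoˡ-≤ _ (s≤s⁻¹ (toℕ<n s))) (m%n<n _ m)

  position-self : ∀ a → position zero a a ≡ 0
  position-self a = begin
    (toℕ a + (m ∸ (toℕ a + 0))) % m   ≡⟨ cong (λ x → (toℕ a + (m ∸ x)) % m) (+-identityʳ (toℕ a)) ⟩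
    (toℕ a + (m ∸ toℕ a)) % m         ≡⟨ cong (_% m) (m+[n∸m]≡n (<⇒≤ (toℕ<n a))) ⟩
    m % m                             ≡⟨ n%n≡0 m ⟩
    0                                 ∎
    where open ≡-Reasoning

  position-injective : ∀ s t a b c → position s a b ≡ position t a c → b ≡ c
  position-injective s t a b c eq = toℕ-injective (begin
    toℕ b                           ≡⟨ position-spec s a b ⟨
    (toℕ a + position s a b) % m    ≡⟨ cong (λ p → (toℕ a + p) % m) eq ⟩
    (toℕ a + position t a c) % m    ≡⟨ position-spec t a c ⟩
    toℕ c                           ∎)
    where open ≡-Reasoning

  position-suc : ∀ s t a b c → suc (position s a b) ≡ position t a c → CyclicSuc b c
  position-suc s t a b c eq = CyclicSuc-% _ (position-spec s a b) (begin
    suc (toℕ a + position s a b) % m    ≡⟨ cong (_% m) (sym (+-suc (toℕ a) _)) ⟩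
    (toℕ a + suc (position s a b)) % m  ≡⟨ cong (λ p → (toℕ a + p) % m) eq ⟩
    (toℕ a + position t a c) % m        ≡⟨ position-spec t a c ⟩
    toℕ c                               ∎)
    where open ≡-Reasoning

  block : Fin 2 → Fin m → Fin m → Fin (suc ⌊ m /2⌋)
  block s a b = fromℕ< (s≤s (⌊n/2⌋-mono (position≤m s a b)))

  block-fibre : ∀ s t a b c → block s a b ≡ block t a c →
    position s a b ≡ position t a c ⊎ (CyclicSuc b c ⊎ CyclicSuc c b)
  block-fibre s t a b c eq
    with ⌊/2⌋-fibre (position s a b) (position t a c) (fromℕ<-injective _ _ _ _ eq)
  ... | inj₁ p≡q          = inj₁ p≡q
  ... | inj₂ (inj₁ 1+p≡q) = inj₂ (inj₁ (position-suc s t a b c 1+p≡q))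
  ... | inj₂ (inj₂ 1+q≡p) = inj₂ (inj₂ (position-suc t s a c b 1+q≡p))

-- Coding the ends of pairs by blocks.

orient : ∀ {A : Set} → Fin 2 → A × A → A × A
orient zero       p = p
orient (suc zero) p = swap p

orient-≈ : ∀ (V : Setoid 0ℓ 0ℓ) s {p r} → orient s p ≡ r → Setoid._≈_ (multiset₂ V) p r
orient-≈ V zero       refl = Setoid.refl (multiset₂ V)
orient-≈ V (suc zero) refl = inj₂ (Setoid.refl V , Setoid.refl V)

module _ {m : ℕ} .{{_ : NonZero m}} (3≤m : 3 ≤ m) where
  private
    G = pairGraph (cycle m 3≤m)
    module G = Graph G
    V = Graph.vertexSetoid (cycle m 3≤m)

  end : Fin 2 → Fin m × Fin m → Fin m × Fin (suc ⌊ m /2⌋)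
  end s p = let (a , b) = orient s p in a , block s a b

  -- Equal codes share the base vertex and the block. Different positions in one block are
  -- consecutive, which gives adjacency; equal positions give the same other vertex. The premise
  -- `p ≡ q` must be literal: for x ≠ y, the first end of (x , y) and the second end of (y , x) have
  -- the same code.
  end-fibre : ∀ s t p q → end s p ≡ end t q → (p G.≈ q × (p ≡ q → s ≡ t)) ⊎ p G.~ q
  end-fibre s t p q eq with orient s p in sp | orient t q in tq
  ... | a , b | a′ , c with cong proj₁ eq
  ... | refl with block-fibre s t a b c (cong proj₂ eq)
  ... | inj₂ b~c = inj₂ (a , b , c , orient-≈ V s sp , orient-≈ V t tq , b~c)
  ... | inj₁ eqp with position-injective s t a b c eqp
  ... | refl = inj₁ (G.trans (orient-≈ V s sp) (G.sym (orient-≈ V t tq)) , same s t sp tq eqp)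
    where
    same : ∀ s t → orient s p ≡ (a , b) → orient t q ≡ (a , b) →
           position s a b ≡ position t a b → p ≡ q → s ≡ t
    same zero       zero       _    _    _   _    = refl
    same (suc zero) (suc zero) _    _    _   _    = refl
    -- Here p = (a , b) and q = (b , a), so `p ≡ q` makes the pair {a , a}: its position is 0 from
    -- the first end and a successor from the second.
    same zero       (suc zero) refl refl pos refl =
      contradiction (trans (sym pos) (position-self a)) (λ ())
    same (suc zero) zero       refl refl pos refl =
      contradiction (trans pos (position-self a)) (λ ())

  -- The `length S * 2` ends inject into the `m * suc ⌊ m /2⌋` codes: adjacency is ruled out in `S`,
  -- and uniqueness turns `p G.≈ q` into equality of indices, hence into the literal equality that
  -- forces s = t.
  independent-length : ∀ S → IsIndependentSet G S → length S ≤ (m * suc ⌊ m /2⌋) / 2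
  independent-length S ind = begin
    length S                ≡⟨ m*n/n≡m (length S) 2 ⟨
    (length S * 2) / 2      ≤⟨ /-monoˡ-≤ 2 (injective⇒≤ end-injective) ⟩
    (m * suc ⌊ m /2⌋) / 2   ∎
    where
    open IsIndependentSet ind
    open ≤-Reasoning

    split : Fin (length S * 2) → Fin (length S) × Fin 2
    split = remQuot {length S} 2

    endOf : Fin (length S) × Fin 2 → Fin m × Fin (suc ⌊ m /2⌋)
    endOf (i , s) = end s (lookup S i)

    endOf-injective : ∀ x y → endOf x ≡ endOf y → x ≡ y
    endOf-injective (i , s) (j , t) eq with end-fibre s t (lookup S i) (lookup S j) eq
    ... | inj₂ adj = contradiction adj
          (nonadjacent (lookup∈ G.vertexSetoid S i) (lookup∈ G.vertexSetoid S j))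
    ... | inj₁ (p≈q , s≡t) with Unique⇒lookup-injective G.vertexSetoid unique i j p≈q
    ... | refl = cong (i ,_) (s≡t refl)

    end-injective : Injective _≡_ _≡_
      (λ x → combine (proj₁ (endOf (split x))) (proj₂ (endOf (split x))))
    end-injective {x} {y} eq with combine-injective _ _ _ _ eq
    ... | eq₁ , eq₂ = trans (sym (combine-remQuot {length S} 2 x))
      (trans (cong (λ (i , s) → combine i s)
                   (endOf-injective (split x) (split y) (cong₂ _,_ eq₁ eq₂)))
             (combine-remQuot {length S} 2 y))

-- Lower bound

-- Gap m e (x , y) says e = m − (y − x).
Gap : ∀ m → ℕ → Fin m × Fin m → Set
Gap m e (x , y) = toℕ y + e ≡ toℕ x + m

-- Moving one element of a pair along the cycle changes the gap by 1, unless it passes between m - 1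
-- and 0: then {a , m - 1} of gap a + 1 becomes {0 , a} of gap m - a, whence the sum m + 1.
Touch : ℕ → ℕ → ℕ → Set
Touch m e f = suc e ≡ f ⊎ suc f ≡ e ⊎ e + f ≡ suc m

Touch-sym : ∀ {m e f} → Touch m e f → Touch m f e
Touch-sym         (inj₁ 1+e≡f)          = inj₂ (inj₁ 1+e≡f)
Touch-sym         (inj₂ (inj₁ 1+f≡e))   = inj₁ 1+f≡e
Touch-sym {e = e} (inj₂ (inj₂ e+f≡1+m)) = inj₂ (inj₂ (trans (+-comm _ e) e+f≡1+m))

-- A gap of at most `m` certifies that a pair is written in sorted order, which fixes the
-- representative of its multiset.
gap⇒≤ : ∀ {m x y e} → e ≤ m → y + e ≡ x + m → x ≤ y
gap⇒≤ {m} {x} {y} e≤m eq =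
  +-cancelʳ-≤ m x y (≤-trans (≤-reflexive (sym eq)) (+-monoʳ-≤ y e≤m))

module _ {m : ℕ} (3≤m : 3 ≤ m) where
  private
    G = pairGraph (cycle m 3≤m)
    module G = Graph G

  -- Both representatives are sorted, so a crosswise match is possible only when the two coordinates
  -- agree.
  gap-unique : ∀ {e f p q} → e ≤ m → f ≤ m → Gap m e p → Gap m f q → p G.≈ q →
    proj₁ p ≡ proj₁ q × e ≡ f
  gap-unique {p = x , y} _   _   gp gq (inj₁ (refl , refl)) =
    refl , +-cancelˡ-≡ (toℕ y) _ _ (trans gp (sym gq))
  gap-unique {p = x , y} e≤m f≤m gp gq (inj₂ (refl , refl))
    with toℕ-injective (≤-antisym (gap⇒≤ e≤m gp) (gap⇒≤ f≤m gq))
  ... | refl = refl , +-cancelˡ-≡ (toℕ y) _ _ (trans gp (sym gq))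

  -- The cases record which coordinate of each sorted pair is the shared vertex `a`, and whether the
  -- step from `b` to `c` wraps around.
  gap-suc : ∀ {e f p q} {a b c : Fin m} → e ≤ m → f ≤ m → Gap m e p → Gap m f q →
    p G.≈ (a , b) → q G.≈ (a , c) → CyclicSuc b c → Touch m e f
  gap-suc {e} {f} {a = a} {b} e≤m f≤m gp gq
      (inj₁ (refl , refl)) (inj₁ (refl , refl)) (inj₁ c≡1+b)
    rewrite c≡1+b =
    inj₂ (inj₁ (+-cancelˡ-≡ (toℕ b) _ _ (trans (+-suc (toℕ b) f) (trans gq (sym gp)))))
  -- Sortedness with c = 0 forces a = 0: the pairs are {0 , m - 1} of gap 1 and {0 , 0} of gap `m`.
  gap-suc {e} {f} {a = a} {b} e≤m f≤m gp gq
      (inj₁ (refl , refl)) (inj₁ (refl , refl)) (inj₂ (1+b≡m , c≡0))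
    rewrite c≡0 =
    inj₂ (inj₂ (cong₂ _+_ e≡1 (trans gq a+m≡m)))
    where
    a+m≡m : toℕ a + m ≡ m
    a+m≡m = cong (_+ m) (n≤0⇒n≡0 (gap⇒≤ f≤m gq))
    e≡1 : e ≡ 1
    e≡1 = +-cancelˡ-≡ (toℕ b) _ _
      (trans gp (trans a+m≡m (trans (sym 1+b≡m) (+-comm 1 (toℕ b)))))
  -- Sortedness would give b + 1 ≤ a ≤ b.
  gap-suc {e} {f} {a = a} {b} e≤m f≤m gp gq
      (inj₁ (refl , refl)) (inj₂ (refl , refl)) (inj₁ c≡1+b)
    rewrite c≡1+b = contradiction (≤-trans (gap⇒≤ f≤m gq) (gap⇒≤ e≤m gp)) 1+n≰n
  gap-suc {e} {f} {a = a} {b} e≤m f≤m gp gq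
      (inj₁ (refl , refl)) (inj₂ (refl , refl)) (inj₂ (1+b≡m , c≡0))
    rewrite c≡0 = inj₂ (inj₂ (+-cancelˡ-≡ (toℕ a + toℕ b) _ _ (begin
      toℕ a + toℕ b + (e + f)     ≡⟨ regroup (toℕ a) (toℕ b) e f ⟩
      (toℕ b + e) + (toℕ a + f)   ≡⟨ cong₂ _+_ gp gq ⟩
      toℕ a + m + m               ≡⟨ cong (λ x → toℕ a + x + m) (sym 1+b≡m) ⟩
      toℕ a + suc (toℕ b) + m     ≡⟨ shift (toℕ a) (toℕ b) m ⟩
      toℕ a + toℕ b + suc m       ∎)))
    where
    open ≡-Reasoning
    regroup : ∀ a b e f → a + b + (e + f) ≡ (b + e) + (a + f)
    regroup = solve-∀
    shift : ∀ a b m → a + suc b + m ≡ a + b + suc m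
    shift = solve-∀
  -- Sortedness gives b ≤ a ≤ b + 1, so one of the two pairs is {a , a}.
  gap-suc {e} {f} {a = a} {b} e≤m f≤m gp gq
      (inj₂ (refl , refl)) (inj₁ (refl , refl)) (inj₁ c≡1+b)
    rewrite c≡1+b with m≤n⇒m<n∨m≡n (gap⇒≤ e≤m gp)
  ... | inj₁ b<a with ≤-antisym b<a (gap⇒≤ f≤m gq)
  ...   | 1+b≡a rewrite sym 1+b≡a =
    inj₁ (trans (+-cancelˡ-≡ (toℕ b) _ _ (trans (+-suc (toℕ b) e) gp))
                (sym (+-cancelˡ-≡ (suc (toℕ b)) _ _ gq)))
  gap-suc {e} {f} {a = a} {b} e≤m f≤m gp gq
      (inj₂ (refl , refl)) (inj₁ (refl , refl)) (inj₁ c≡1+b)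
      | inj₂ b≡a rewrite sym b≡a =
    inj₂ (inj₁ (trans (+-cancelˡ-≡ (toℕ b) _ _ (trans (+-suc (toℕ b) f) gq))
                      (sym (+-cancelˡ-≡ (toℕ b) _ _ gp))))
  -- Sortedness gives b ≤ a ≤ 0 with `b` the last vertex, which a cycle of length at least 3
  -- excludes.
  gap-suc {e} {f} {a = a} {b} e≤m f≤m gp gq
      (inj₂ (refl , refl)) (inj₁ (refl , refl)) (inj₂ (1+b≡m , c≡0))
    rewrite c≡0 = contradiction 3≤m (<⇒≱ (s≤s (≤-trans (≤-reflexive (sym 1+b≡m)) (s≤s b≤1))))
    where
    b≤1 : toℕ b ≤ 1
    b≤1 = ≤-trans (gap⇒≤ e≤m gp) (≤-trans (gap⇒≤ {y = 0} f≤m gq) z≤n)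
  gap-suc {e} {f} {a = a} {b} e≤m f≤m gp gq
      (inj₂ (refl , refl)) (inj₂ (refl , refl)) (inj₁ c≡1+b)
    rewrite c≡1+b =
    inj₁ (+-cancelˡ-≡ (toℕ a) _ _ (trans (+-suc (toℕ a) e) (trans (cong suc gp) (sym gq))))
  -- As `b` is the last vertex and b ≤ a, the pairs are {m - 1 , m - 1} of gap `m` and {0 , m - 1}
  -- of gap 1.
  gap-suc {e} {f} {a = a} {b} e≤m f≤m gp gq
      (inj₂ (refl , refl)) (inj₂ (refl , refl)) (inj₂ (1+b≡m , c≡0))
    rewrite c≡0 = inj₂ (inj₂ (trans (cong₂ _+_ e≡m f≡1) (+-comm m 1)))
    where
    a≡b : toℕ a ≡ toℕ b
    a≡b = ≤-antisym (s≤s⁻¹ (≤-trans (toℕ<n a) (≤-reflexive (sym 1+b≡m)))) (gap⇒≤ e≤m gp)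
    e≡m : e ≡ m
    e≡m = +-cancelˡ-≡ (toℕ b) _ _ (trans (cong (_+ e) (sym a≡b)) gp)
    f≡1 : f ≡ 1
    f≡1 = +-cancelˡ-≡ (toℕ b) _ _
      (trans (cong (_+ f) (sym a≡b)) (trans gq (trans (sym 1+b≡m) (+-comm 1 (toℕ b)))))

  gap-adjacent : ∀ {e f p q} → e ≤ m → f ≤ m → Gap m e p → Gap m f q → p G.~ q → Touch m e f
  gap-adjacent e≤m f≤m gp gq (_ , _ , _ , p≈ , q≈ , inj₁ b→c) = gap-suc e≤m f≤m gp gq p≈ q≈ b→c
  gap-adjacent e≤m f≤m gp gq (_ , _ , _ , p≈ , q≈ , inj₂ c→b) =
    Touch-sym (gap-suc f≤m e≤m gq gp q≈ p≈ c→b)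

  -- Independent sets made of strips of constant gap.

  strip : ∀ {e} → e ≤ m → Fin e → Fin m × Fin m
  strip {e} e≤m i = inject≤ i e≤m , cast (m∸n+n≡m e≤m) ((m ∸ e) ↑ʳ i)

  strip-gap : ∀ {e} (e≤m : e ≤ m) i → Gap m e (strip e≤m i)
  strip-gap {e} e≤m i = begin
    toℕ (cast (m∸n+n≡m e≤m) ((m ∸ e) ↑ʳ i)) + e   ≡⟨ cong (_+ e) (toℕ-cast (m∸n+n≡m e≤m) ((m ∸ e) ↑ʳ i)) ⟩
    toℕ ((m ∸ e) ↑ʳ i) + e                        ≡⟨ cong (_+ e) (toℕ-↑ʳ (m ∸ e) i) ⟩
    (m ∸ e) + toℕ i + e                           ≡⟨ rearrange (m ∸ e) (toℕ i) e ⟩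
    toℕ i + ((m ∸ e) + e)                         ≡⟨ cong₂ _+_ (sym (toℕ-inject≤ i e≤m)) (m∸n+n≡m e≤m) ⟩
    toℕ (inject≤ i e≤m) + m                       ∎
    where
    open ≡-Reasoning
    rearrange : ∀ x y z → x + y + z ≡ y + (x + z)
    rearrange = solve-∀

  strips : ∀ {E} → All (_≤ m) E → List (Fin m × Fin m)
  strips []          = []
  strips (e≤m ∷ E≤m) = tabulate (strip e≤m) ++ strips E≤m

  length-strips : ∀ {E} (E≤m : All (_≤ m) E) → length (strips E≤m) ≡ sum E
  length-strips []          = refl
  length-strips (e≤m ∷ E≤m) = trans (length-++ (tabulate (strip e≤m)))
    (cong₂ _+_ (length-tabulate (strip e≤m)) (length-strips E≤m))

  HasGapIn : List ℕ → Fin m × Fin m → Set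
  HasGapIn E p = ∃[ e ] (e ∈ E × e ≤ m × Gap m e p)

  strips-gap : ∀ {E} (E≤m : All (_≤ m) E) → All (HasGapIn E) (strips E≤m)
  strips-gap []          = []
  strips-gap (e≤m ∷ E≤m) = All.++⁺
    (All.tabulate⁺ (λ i → _ , here refl , e≤m , strip-gap e≤m i))
    (All.map (λ (e , e∈E , rest) → e , there e∈E , rest) (strips-gap E≤m))

  -- Within a strip the first coordinate tells the pairs apart; across strips the gap does.
  strips-unique : ∀ {E} (E≤m : All (_≤ m) E) → Unique E → UniqueSetoid.Unique G.vertexSetoid (strips E≤m)
  strips-unique []          []        = []
  strips-unique (e≤m ∷ E≤m) (e∉E ∷ u) = AllPairs.++⁺
    (AllPairs.tabulate⁺ (λ {i} {j} i≢j p≈q → i≢j (inject≤-injective e≤m e≤m i j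
      (proj₁ (gap-unique e≤m e≤m (strip-gap e≤m i) (strip-gap e≤m j) p≈q)))))
    (strips-unique E≤m u)
    (All.tabulate⁺ (λ i → All.map
      (λ (f , f∈E , f≤m , gq) p≈q →
        All.lookup e∉E f∈E (proj₂ (gap-unique e≤m f≤m (strip-gap e≤m i) gq p≈q)))
      (strips-gap E≤m)))

  strips-independent : ∀ {E} (E≤m : All (_≤ m) E) → Unique E →
    (∀ {e f} → e ∈ E → f ∈ E → ¬ Touch m e f) → IsIndependentSet G (strips E≤m)
  strips-independent {E} E≤m u ¬touch = record
    { unique      = strips-unique E≤m u
    ; nonadjacent = λ {p} {q} p∈ q∈ p~q →
        -- Membership is up to `_≈_`, so the gaps are read from the sorted pairs actually listed,
        -- and adjacency is carried over to them.
        let (e , e∈ , e≤m , ge) , p≈ = All.lookupAny (strips-gap E≤m) p∈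
            (f , f∈ , f≤m , gf) , q≈ = All.lookupAny (strips-gap E≤m) q∈
        in ¬touch e∈ f∈ (gap-adjacent e≤m f≤m ge gf (G.~-resp-≈ p≈ q≈ p~q))
    }

-- The gap sets for even and odd cycles.

evens : ℕ → List ℕ
evens = applyDownFrom (λ i → 2 * suc i)

odds : ℕ → ℕ → List ℕ
odds j = applyDownFrom (λ i → suc (2 * (suc j + i)))

sum-evens : ∀ n → sum (evens n) ≡ n * (n + 1)
sum-evens zero    = refl
sum-evens (suc n) = trans (cong (2 * suc n +_) (sum-evens n)) (step n)
  where
  step : ∀ n → 2 * suc n + n * (n + 1) ≡ suc n * (suc n + 1)
  step = solve-∀

sum-odds : ∀ j n → sum (odds j n) ≡ n * (2 * suc j) + n * n
sum-odds j zero    = refl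
sum-odds j (suc n) = trans (cong (suc (2 * (suc j + n)) +_) (sum-odds j n)) (step j n)
  where
  step : ∀ j n → suc (2 * (suc j + n)) + (n * (2 * suc j) + n * n) ≡ suc n * (2 * suc j) + suc n * suc n
  step = solve-∀

evens-unique : ∀ n → Unique (evens n)
evens-unique n = AllPairs.applyDownFrom⁺₁ _ n
  (λ j<i _ eq → <⇒≢ j<i (sym (suc-injective (*-cancelˡ-≡ _ _ 2 eq))))

odds-unique : ∀ j n → Unique (odds j n)
odds-unique j n = AllPairs.applyDownFrom⁺₁ _ n
  (λ l<i _ eq → <⇒≢ l<i (sym (+-cancelˡ-≡ (suc j) _ _ (*-cancelˡ-≡ _ _ 2 (suc-injective eq)))))

-- Parity suffices: even gaps never differ by 1, and m + 1 is odd.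
even-gaps : ∀ k (3≤m : 3 ≤ 2 * k) →
  ∃[ S ] (IsIndependentSet (pairGraph (cycle (2 * k) 3≤m)) S × length S ≡ k * (k + 1))
even-gaps k 3≤m =
  strips 3≤m E≤m ,
  strips-independent 3≤m E≤m (evens-unique k) ¬touch ,
  trans (length-strips 3≤m E≤m) (sum-evens k)
  where
  E≤m : All (_≤ 2 * k) (evens k)
  E≤m = All.applyDownFrom⁺₁ _ k (*-monoʳ-≤ 2)

  ¬touch : ∀ {e f} → e ∈ evens k → f ∈ evens k → ¬ Touch (2 * k) e f
  ¬touch e∈ f∈ touch with ∈-applyDownFrom⁻ _ e∈ | ∈-applyDownFrom⁻ _ f∈
  ¬touch e∈ f∈ (inj₁ eq)        | x , _ , refl | y , _ , refl = even≢odd (suc y) (suc x) (sym eq)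
  ¬touch e∈ f∈ (inj₂ (inj₁ eq)) | x , _ , refl | y , _ , refl = even≢odd (suc x) (suc y) (sym eq)
  ¬touch e∈ f∈ (inj₂ (inj₂ eq)) | x , _ , refl | y , _ , refl =
    even≢odd (suc x + suc y) k (trans (*-distribˡ-+ 2 (suc x) (suc y)) eq)

-- Here `j` and `n` stand for ⌊k/2⌋ and ⌈k/2⌉, where m = 2k + 1. The gaps kept are 2 , ... , 2j and
-- 2j + 3 , ... , m. The balance between `j` and `n` keeps the sum of two even gaps below m + 1 and
-- that of two odd gaps above it.
module _ (j n : ℕ) (j≤n : j ≤ n) (n≤1+j : n ≤ suc j) where
  private
    m = 2 * (j + n) + 1
    E = evens j ++ odds j n

    Half : ℕ → Set
    Half e = ∃[ x ] (e ≡ 2 * x × x ≤ j ⊎ e ≡ suc (2 * x) × j < x)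

    half : ∀ {e} → e ∈ E → Half e
    half e∈ with ∈-++⁻ (evens j) e∈
    ... | inj₁ e∈evens with x , x<j , refl ← ∈-applyDownFrom⁻ _ e∈evens = suc x , inj₁ (refl , x<j)
    ... | inj₂ e∈odds with x , _ , refl ← ∈-applyDownFrom⁻ _ e∈odds = suc j + x , inj₂ (refl , m≤m+n (suc j) x)

    1+m≡ : suc m ≡ 2 * suc (j + n)
    1+m≡ = lemma (j + n)
      where
      lemma : ∀ k → suc (2 * k + 1) ≡ 2 * suc k
      lemma = solve-∀

    -- The omitted gaps 2j + 1 and 2j + 2 keep the two parities more than 1 apart, and their sum is
    -- odd while m + 1 is even.
    even-odd : ∀ x y → x ≤ j → j < y → ¬ Touch m (2 * x) (suc (2 * y))
    even-odd x y x≤j j<y (inj₁ eq) =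
      <⇒≢ (≤-<-trans x≤j j<y) (*-cancelˡ-≡ x y 2 (suc-injective eq))
    even-odd x y x≤j j<y (inj₂ (inj₁ eq)) =
      <⇒≢ (≤-<-trans x≤j (m<n⇒m<1+n j<y)) (sym (*-cancelˡ-≡ (suc y) x 2 (trans (*-suc 2 y) eq)))
    even-odd x y x≤j j<y (inj₂ (inj₂ eq)) =
      even≢odd (suc (j + n)) (x + y) (trans (sym 1+m≡) (trans (sym eq) (lemma x y)))
      where
      lemma : ∀ x y → 2 * x + suc (2 * y) ≡ suc (2 * (x + y))
      lemma = solve-∀

    ¬touch : ∀ {e f} → e ∈ E → f ∈ E → ¬ Touch m e f
    ¬touch e∈ f∈ touch with half e∈ | half f∈
    ... | x , inj₁ (refl , x≤j) | y , inj₂ (refl , j<y) = even-odd x y x≤j j<y touch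
    ... | x , inj₂ (refl , j<x) | y , inj₁ (refl , y≤j) = even-odd y x y≤j j<x (Touch-sym touch)
    ¬touch _ _ (inj₁ eq)        | x , inj₁ (refl , _) | y , inj₁ (refl , _) = even≢odd y x (sym eq)
    ¬touch _ _ (inj₂ (inj₁ eq)) | x , inj₁ (refl , _) | y , inj₁ (refl , _) = even≢odd x y (sym eq)
    -- Here x + y ≤ j + n, short of the j + n + 1 required for m + 1.
    ¬touch _ _ (inj₂ (inj₂ eq)) | x , inj₁ (refl , x≤j) | y , inj₁ (refl , y≤j) =
      <⇒≢ (s≤s (+-mono-≤ x≤j (≤-trans y≤j j≤n)))
          (*-cancelˡ-≡ (x + y) _ 2 (trans (*-distribˡ-+ 2 x y) (trans eq 1+m≡)))
    ¬touch _ _ (inj₁ eq)        | x , inj₂ (refl , _) | y , inj₂ (refl , _) =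
      even≢odd (suc x) y (trans (*-suc 2 x) eq)
    ¬touch _ _ (inj₂ (inj₁ eq)) | x , inj₂ (refl , _) | y , inj₂ (refl , _) =
      even≢odd (suc y) x (trans (*-suc 2 y) eq)
    -- Here x + y ≥ (j + 1) + n, so x + y + 1 exceeds the required j + n + 1.
    ¬touch _ _ (inj₂ (inj₂ eq)) | x , inj₂ (refl , j<x) | y , inj₂ (refl , j<y) =
      <⇒≢ (s≤s (+-mono-≤ j<x (≤-trans n≤1+j j<y)))
          (sym (*-cancelˡ-≡ (suc (x + y)) _ 2 (trans (lemma x y) (trans eq 1+m≡))))
      where
      lemma : ∀ x y → 2 * suc (x + y) ≡ suc (2 * x) + suc (2 * y)
      lemma = solve-∀

    E≤m : All (_≤ m) E
    E≤m = All.++⁺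
      (All.applyDownFrom⁺₁ _ j (λ i<j → m≤n⇒m≤n+o 1 (*-monoʳ-≤ 2 (≤-trans i<j (m≤m+n j n)))))
      (All.applyDownFrom⁺₁ _ n (λ {i} i<n → ≤-trans
        (s≤s (*-monoʳ-≤ 2 (≤-trans (≤-reflexive (sym (+-suc j i))) (+-monoʳ-≤ j i<n))))
        (≤-reflexive (+-comm 1 (2 * (j + n))))))

    E-unique : Unique E
    E-unique = AllPairs.++⁺ (evens-unique j) (odds-unique j n)
      (All.applyDownFrom⁺₁ _ j (λ {x} _ → All.applyDownFrom⁺₁ _ n (λ {y} _ → even≢odd (suc x) (suc j + y))))

  odd-gaps : (3≤m : 3 ≤ m) →
    ∃[ S ] (IsIndependentSet (pairGraph (cycle m 3≤m)) S × length S ≡ (j + n) * (j + n + 1) + n)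
  odd-gaps 3≤m =
    strips 3≤m E≤m ,
    strips-independent 3≤m E≤m E-unique ¬touch ,
    trans (length-strips 3≤m E≤m) (trans (sum-++ (evens j) (odds j n))
      (trans (cong₂ _+_ (sum-evens j) (sum-odds j n)) (lemma j n)))
    where
    lemma : ∀ j n → j * (j + 1) + (n * (2 * suc j) + n * n) ≡ (j + n) * (j + n + 1) + n
    lemma = solve-∀

-- Matching the two bounds.

odd-cycle : ∀ k (3≤m : 3 ≤ 2 * k + 1) →
  IsIndependenceNumber (pairGraph (cycle (2 * k + 1) 3≤m)) (k * (k + 1) + (k + 1) / 2)
odd-cycle k 3≤m = record { attained = attained ; maximal = maximal }
  where
  G : ∀ k → 3 ≤ 2 * k + 1 → Graph
  G k 3≤m = pairGraph (cycle (2 * k + 1) 3≤m)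

  j = ⌊ k /2⌋
  n = ⌈ k /2⌉

  n≤1+j : n ≤ suc j
  n≤1+j = ⌊n/2⌋-mono (n≤1+n (suc k))

  n≡ : n ≡ (k + 1) / 2
  n≡ = trans (⌊n/2⌋≡n/2 (suc k)) (cong (_/ 2) (+-comm 1 k))

  attained : ∃[ S ] (IsIndependentSet (G k 3≤m) S × length S ≡ k * (k + 1) + (k + 1) / 2)
  attained = subst (λ t → ∃[ S ] (IsIndependentSet (G k 3≤m) S × length S ≡ k * (k + 1) + t)) n≡
    -- The motive quantifies over the bound, whose type changes along with `k′`.
    (subst (λ k′ → (3≤m′ : 3 ≤ 2 * k′ + 1) →
              ∃[ S ] (IsIndependentSet (G k′ 3≤m′) S × length S ≡ k′ * (k′ + 1) + n))
      (⌊n/2⌋+⌈n/2⌉≡n k) (odd-gaps j n (⌊n/2⌋≤⌈n/2⌉ k) n≤1+j) 3≤m)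

  maximal : ∀ S → IsIndependentSet (G k 3≤m) S → length S ≤ k * (k + 1) + (k + 1) / 2
  maximal S ind = begin
    length S                                      ≤⟨ independent-length {{m+1+n-nonZero}} 3≤m S ind ⟩
    ((2 * k + 1) * suc ⌊ 2 * k + 1 /2⌋) / 2       ≡⟨ cong (λ h → ((2 * k + 1) * suc h) / 2) ⌊m/2⌋≡k ⟩
    ((2 * k + 1) * suc k) / 2                     ≡⟨ cong (_/ 2) (expand k) ⟩
    -- The first summand is even, so rounding affects only `k + 1`.
    (k * (k + 1) * 2 + (k + 1)) / 2               ≡⟨ +-distrib-/-∣ˡ (k + 1) (n∣m*n (k * (k + 1)) {2}) ⟩
    k * (k + 1) * 2 / 2 + (k + 1) / 2             ≡⟨ cong (_+ (k + 1) / 2) (m*n/n≡m (k * (k + 1)) 2) ⟩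
    k * (k + 1) + (k + 1) / 2                     ∎
    where
    open ≤-Reasoning
    m+1+n-nonZero : NonZero (2 * k + 1)
    m+1+n-nonZero = subst NonZero (+-comm 1 (2 * k)) _
    ⌊m/2⌋≡k : ⌊ 2 * k + 1 /2⌋ ≡ k
    ⌊m/2⌋≡k = trans (cong ⌊_/2⌋ (+-comm (2 * k) 1)) (⌊1+2n/2⌋≡n k)
    expand : ∀ k → (2 * k + 1) * suc k ≡ k * (k + 1) * 2 + (k + 1)
    expand = solve-∀

even-cycle : ∀ k (3≤m : 3 ≤ 2 * k) →
  IsIndependenceNumber (pairGraph (cycle (2 * k) 3≤m)) (k * (k + 1))
-- The bound excludes k = 0, and the successor form lets instance search find `NonZero (2 * k)`.
even-cycle (suc k′) 3≤m = record { attained = even-gaps k 3≤m ; maximal = maximal }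
  where
  k = suc k′

  maximal : ∀ S → IsIndependentSet (pairGraph (cycle (2 * k) 3≤m)) S → length S ≤ k * (k + 1)
  maximal S ind = begin
    length S                            ≤⟨ independent-length 3≤m S ind ⟩
    (2 * k * suc ⌊ 2 * k /2⌋) / 2       ≡⟨ cong (λ h → (2 * k * suc h) / 2) (⌊2n/2⌋≡n k) ⟩
    (2 * k * suc k) / 2                 ≡⟨ cong (_/ 2) (expand k) ⟩
    k * (k + 1) * 2 / 2                 ≡⟨ m*n/n≡m (k * (k + 1)) 2 ⟩
    k * (k + 1)                         ∎
    where
    open ≤-Reasoning
    expand : ∀ k → 2 * k * suc k ≡ k * (k + 1) * 2
    expand = solve-∀

theorem1p5 : (m : ℕ) (3≤m : 3 ≤ m) (k : ℕ) →
    (m ≡ 2 * k + 1 → IsIndependenceNumber (pairGraph (cycle m 3≤m)) (k * (k + 1) + (k + 1) / 2)) ×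
    (m ≡ 2 * k → IsIndependenceNumber (pairGraph (cycle m 3≤m)) (k * (k + 1)))
theorem1p5 m 3≤m k = (λ { refl → odd-cycle k 3≤m }) , (λ { refl → even-cycle k 3≤m })
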